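{- There exists a finite colouring of $\mathbb{N}^{(2)}$ such that there do not exist natural numbers $x_1<x_2<\cdots$ for which all the pairs $(x_{k_1}-x_{k_2}+x_{k_3}-\cdots+x_{k_t},\ x_{k_{t+1}})$, where $t$ is odd and $k_1<k_2<\cdots<k_{t+1}$, have the same colour.
   Context: $\mathbb{N}^{(2)}$ denotes the set of pairs $(a,b)$ of natural numbers with $a<b$ (the edge set of the complete graph on $\mathbb{N}$). Note that for $x_1<x_2<\cdots$, $t$ odd and $k_1<\cdots<k_{t+1}$, one has $0<x_{k_1}-x_{k_2}+\cdots+x_{k_t}<x_{k_{t+1}}$, so these are indeed elements of $\mathbb{N}^{(2)}$. -}

module Defs where

open import Data.Nat using (ℕ; zero; suc)
open import Data.Integer using (ℤ; +_; _-_)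
open import Data.List using (List; []; _∷_)

altSum : List ℕ → ℤ
altSum []      = + 0
altSum (a ∷ l) = + a - altSum l

data IsOdd : ℕ → Set where
  one  : IsOdd 1
  plus2 : ∀ {n} → IsOdd n → IsOdd (suc (suc n))

{-# OPTIONS --safe #-}
module Submission where

-- Let a + c = b, and scan the binary digits of a and c upwards. Colour (a , b) by
-- the number, modulo 4, of changes between positions at which only a has the digit
-- 1 and positions at which only c has. If the xₖ converge 2-adically and are widely
-- spaced, then along an alternating sum the digits 1 sit alternately (between the
-- successive xₖ) on the side of c and on that of a, so each term contributes an odd
-- number of changes, and the contribution of xₖ does not depend on its sign, as
-- exchanging a and c preserves changes. With l beyond all other indices, the terms
-- 1, 1 - 2 + 3, 1 - 2 + 4 and 1 - 3 + 4 then force twice an odd number to vanish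
-- modulo 4.
--
-- Borrows from the subtractions are controlled by the 2-adic limit: either it is a
-- natural number p, and p + 2^M serves as a truncation from which one can subtract,
-- or its truncations are unbounded.

open import Defs
open import Data.Nat using (ℕ; zero; suc; _+_; _*_; _∸_; _^_; _/_; _%_; _⊔_; _<_; _≤_; z≤n; s≤s; s≤s⁻¹)
open import Data.Nat.Properties
open import Data.Nat.DivMod
open import Data.Nat.Divisibility using (divides-refl)
open import Data.Nat.Tactic.RingSolver using (solve-∀)
open import Data.Fin using (Fin)
open import Data.Fin.Patterns using (0F; 1F; 2F; 3F)
open import Data.Integer using (∣_∣)
import Data.Integer as ℤ
import Data.Integer.Tactic.RingSolver as ℤ-RingSolver
open import Data.List using (List; []; _∷_; _++_; map; length)
open import Data.List.Relation.Unary.Linked using (Linked; [-]; _∷_)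
open import Data.Product using (Σ; ∃₂; _×_; _,_)
open import Data.Sum using (_⊎_; inj₁; inj₂)
open import Data.Empty using (⊥)
open import Function using (_∘_; id)
open import Relation.Nullary using (¬_)
open import Relation.Binary.PropositionalEquality using (_≡_; _≢_; refl; sym; trans; cong; cong₂; subst; module ≡-Reasoning)

-- Counting changes modulo 4

toOdd toEven rot : Fin 4 → Fin 4
toOdd 0F = 1F
toOdd 1F = 1F
toOdd 2F = 3F
toOdd 3F = 3F
toEven 0F = 0F
toEven 1F = 2F
toEven 2F = 2F
toEven 3F = 0F
rot 0F = 1F
rot 1F = 2F
rot 2F = 3F
rot 3F = 0F

-- `Even` goes through `rot` so that facts about odd states pass to even ones by `run-swap`.
Odd Even : Fin 4 → Set
Odd s = toOdd s ≡ s
Even s = Odd (rot s)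

toOdd-odd : ∀ s → Odd (toOdd s)
toOdd-odd 0F = refl
toOdd-odd 1F = refl
toOdd-odd 2F = refl
toOdd-odd 3F = refl

rot-injective : ∀ {s s′} → rot s ≡ rot s′ → s ≡ s′
rot-injective {s} {s′} eq = trans (sym (rot⁴ s)) (trans (cong (rot ∘ rot ∘ rot) eq) (rot⁴ s′))
  where
  rot⁴ : ∀ s → rot (rot (rot (rot s))) ≡ s
  rot⁴ 0F = refl
  rot⁴ 1F = refl
  rot⁴ 2F = refl
  rot⁴ 3F = refl

rot²≢id : ∀ s → rot (rot s) ≢ s
rot²≢id 0F ()
rot²≢id 1F ()
rot²≢id 2F ()
rot²≢id 3F ()

odd-even : ∀ {n m} → Odd n → Even m → n ≡ rot m ⊎ n ≡ rot (rot (rot m))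
odd-even {1F} {0F} _ _ = inj₁ refl
odd-even {1F} {2F} _ _ = inj₂ refl
odd-even {3F} {0F} _ _ = inj₂ refl
odd-even {3F} {2F} _ _ = inj₁ refl
odd-even {0F} () _
odd-even {2F} () _
odd-even {1F} {1F} _ ()
odd-even {1F} {3F} _ ()
odd-even {3F} {1F} _ ()
odd-even {3F} {3F} _ ()

-- The parity of the state records on which side the last lone digit 1 was seen.
step : ℕ → ℕ → Fin 4 → Fin 4
step 0 1 s = toOdd s
step 1 0 s = toEven s
step _ _ s = s

-- Adding 1 modulo 4 flips parity, so it conjugates `toOdd` and `toEven` into each other.
step-swap : ∀ d e s → step e d (rot s) ≡ rot (step d e s)
step-swap 0 0 s = refl
step-swap 0 1 0F = refl
step-swap 0 1 1F = refl
step-swap 0 1 2F = refl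
step-swap 0 1 3F = refl
step-swap 0 (suc (suc e)) s = refl
step-swap 1 0 0F = refl
step-swap 1 0 1F = refl
step-swap 1 0 2F = refl
step-swap 1 0 3F = refl
step-swap 1 1 s = refl
step-swap 1 (suc (suc e)) s = refl
step-swap (suc (suc d)) 0 s = refl
step-swap (suc (suc d)) 1 s = refl
step-swap (suc (suc d)) (suc (suc e)) s = refl

step-0ˡ : ∀ e {s} → Odd s → step 0 e s ≡ s
step-0ˡ 0 o = refl
step-0ˡ 1 o = o
step-0ˡ (suc (suc e)) o = refl

-- Reading binary digits

run : ℕ → ℕ → ℕ → Fin 4 → Fin 4
run zero    a c s = s
run (suc k) a c s = run k (a / 2) (c / 2) (step (a % 2) (c % 2) s)

run-swap : ∀ k a c s → run k c a (rot s) ≡ rot (run k a c s)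
run-swap zero    a c s = refl
run-swap (suc k) a c s = trans
  (cong (run k (c / 2) (a / 2)) (step-swap (a % 2) (c % 2) s))
  (run-swap k (a / 2) (c / 2) _)

-- Against zero digits only `toOdd` can act, and it fixes odd states.
run-0ˡ : ∀ k c {s} → Odd s → run k 0 c s ≡ s
run-0ˡ zero    c o = refl
run-0ˡ (suc k) c o = trans (cong (run k 0 (c / 2)) (step-0ˡ (c % 2) o)) (run-0ˡ k (c / 2) o)

run-0ʳ : ∀ k c {s} → Even s → run k c 0 s ≡ s
run-0ʳ k c {s} e = rot-injective (trans (sym (run-swap k c 0 s)) (run-0ˡ k c e))

run-00 : ∀ k s → run k 0 0 s ≡ s
run-00 zero    s = refl
run-00 (suc k) s = run-00 k s

half< : ∀ {a} k → a < 2 ^ suc k → a / 2 < 2 ^ k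
half< {a} k a< = m<n*o⇒m/o<n (subst (a <_) (*-comm 2 (2 ^ k)) a<)

-- The leading digit of c lies strictly above that of a.
run-leadʳ : ∀ k {a c} s → a * 2 ≤ c → 0 < c → c < 2 ^ k → Odd (run k a c s)
run-leadʳ zero {c = suc c} s _ _ (s≤s ())
run-leadʳ (suc k) {zero} {1} s _ _ _ = subst Odd (sym (run-00 k (toOdd s))) (toOdd-odd s)
run-leadʳ (suc k) {suc a} {1} s (s≤s ()) _ _
run-leadʳ (suc k) {a} {c@(suc (suc _))} s a≤c _ c< =
  run-leadʳ k _ (≤-trans (m/n*n≤m a 2) a≤c/2) (m≥n⇒m/n>0 {c} {2} (s≤s (s≤s z≤n))) (half< k c<)
  where
  a≤c/2 : a ≤ c / 2
  a≤c/2 = subst (_≤ c / 2) (m*n/n≡m a 2) (/-monoˡ-≤ 2 a≤c)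

run-leadˡ : ∀ k {a c} s → a * 2 ≤ c → 0 < c → c < 2 ^ k → Even (run k c a s)
run-leadˡ k {a} {c} s a≤c 0<c c< = subst Odd (run-swap k c a s) (run-leadʳ k (rot s) a≤c 0<c c<)

-- Past the leading digits only pairs of zeros are read, and these leave the state alone.
run-fuel : ∀ i j {a c} s → a < 2 ^ i → c < 2 ^ i → a < 2 ^ j → c < 2 ^ j → run i a c s ≡ run j a c s
run-fuel zero j s (s≤s z≤n) (s≤s z≤n) _ _ = sym (run-00 j s)
run-fuel (suc i) zero s _ _ (s≤s z≤n) (s≤s z≤n) = run-00 i s
run-fuel (suc i) (suc j) s a<i c<i a<j c<j =
  run-fuel i j _ (half< i a<i) (half< i c<i) (half< j a<j) (half< j c<j)

private
  2*p*a≡p*a*2 : ∀ a p → 2 * p * a ≡ p * a * 2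
  2*p*a≡p*a*2 = solve-∀

shift/2 : ∀ i a a′ → (a + 2 ^ suc i * a′) / 2 ≡ a / 2 + 2 ^ i * a′
shift/2 i a a′ rewrite 2*p*a≡p*a*2 a′ (2 ^ i) =
  trans (+-distrib-/-∣ʳ a (divides-refl (2 ^ i * a′))) (cong (a / 2 +_) (m*n/n≡m (2 ^ i * a′) 2))

shift%2 : ∀ i a a′ → (a + 2 ^ suc i * a′) % 2 ≡ a % 2
shift%2 i a a′ rewrite 2*p*a≡p*a*2 a′ (2 ^ i) = [m+kn]%n≡m%n a (2 ^ i * a′) 2

-- The bounds prevent carries: each sum has the `i` digits of its low part followed by those of its
-- high part.
run-+ : ∀ i j {a c} a′ c′ s → a < 2 ^ i → c < 2 ^ i →
  run (i + j) (a + 2 ^ i * a′) (c + 2 ^ i * c′) s ≡ run j a′ c′ (run i a c s)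
run-+ zero j a′ c′ s (s≤s z≤n) (s≤s z≤n) = cong₂ (λ a c → run j a c s) (*-identityˡ a′) (*-identityˡ c′)
run-+ (suc i) j {a} {c} a′ c′ s a< c<
  rewrite shift/2 i a a′ | shift/2 i c c′ | shift%2 i a a′ | shift%2 i c c′ =
  run-+ i j a′ c′ _ (half< i a<) (half< i c<)

-- The colouring and four incompatible pairs

n<2^n : ∀ n → n < 2 ^ n
n<2^n zero = s≤s z≤n
n<2^n (suc n) = subst (suc (suc n) ≤_) (cong (2 ^ n +_) (sym (+-identityʳ (2 ^ n))))
  (+-mono-≤ (m^n>0 2 n) (n<2^n n))

-- As `b < 2 ^ b`, reading `b` digits exhausts both numbers when `a ≤ b`.
χ : ℕ → ℕ → Fin 4
χ a b = run b a (b ∸ a) 0F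

-- The difference `c` is supplied already cut into blocks, so no borrow has to be traced.
χ-run : ∀ M K {a₀ c₀ a₁ c₁ a₂ c₂ b} → a₀ < 2 ^ M → c₀ < 2 ^ M → a₁ < 2 ^ K → c₁ < 2 ^ K →
  let a = a₀ + 2 ^ M * (a₁ + 2 ^ K * a₂)
      c = c₀ + 2 ^ M * (c₁ + 2 ^ K * c₂)
  in a + c ≡ b → χ a b ≡ run b a₂ c₂ (run K a₁ c₁ (run M a₀ c₀ 0F))
χ-run M K {a₀} {c₀} {a₁} {c₁} {a₂} {c₂} a₀< c₀< a₁< c₁< refl = begin
  run b a (b ∸ a) 0F                                   ≡⟨ cong (λ c → run b a c 0F) (m+n∸m≡n a c) ⟩
  -- Reading `M + K` further digits is harmless and leaves `b` of them for the top block.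
  run b a c 0F                                         ≡⟨ run-fuel b (M + (K + b)) 0F (small (m≤m+n a c)) (small (m≤n+m c a))
                                                            (big (m≤m+n a c)) (big (m≤n+m c a)) ⟩
  run (M + (K + b)) a c 0F                             ≡⟨ run-+ M (K + b) _ _ 0F a₀< c₀< ⟩
  run (K + b) _ _ (run M a₀ c₀ 0F)                     ≡⟨ run-+ K b _ _ _ a₁< c₁< ⟩
  run b a₂ c₂ (run K a₁ c₁ (run M a₀ c₀ 0F))           ∎
  where
  open ≡-Reasoning
  a = a₀ + 2 ^ M * (a₁ + 2 ^ K * a₂)
  c = c₀ + 2 ^ M * (c₁ + 2 ^ K * c₂)
  b = a + c
  small : ∀ {d} → d ≤ b → d < 2 ^ b
  small d≤b = ≤-<-trans d≤b (n<2^n b)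
  big : ∀ {d} → d ≤ b → d < 2 ^ (M + (K + b))
  big d≤b = <-≤-trans (small d≤b) (^-monoʳ-≤ 2 (≤-trans (m≤n+m b K) (m≤n+m (K + b) M)))

private
  sum₁ : ∀ p q x t Q Z → x + p * (0 + q * 0) + (t + p * (Q + q * Z)) ≡ x + t + p * (Q + q * Z)
  sum₁ = solve-∀

  sum₁₂₃ : ∀ p q y u X V Z →
    u + p * (X + q * 0) + (y + p * (V + q * Z)) ≡ y + u + p * (X + V + q * Z)
  sum₁₂₃ = solve-∀

  sum₁₃₄ : ∀ p q x t X V Y D →
    x + p * (V + q * Y) + (t + p * (X + q * D)) ≡ x + t + p * (X + V + q * (Y + D))
  sum₁₃₄ = solve-∀

  sum₁₂₄ : ∀ p q y u Q Y D →
    u + p * (Q + q * Y) + (y + p * (0 + q * D)) ≡ y + u + p * (Q + q * (Y + D))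
  sum₁₂₄ = solve-∀

  pad₁ : ∀ p q x → x ≡ x + p * (0 + q * 0)
  pad₁ = solve-∀

  pad₂ : ∀ p q u X → u + p * X ≡ u + p * (X + q * 0)
  pad₂ = solve-∀

-- With x₁, x₂ = x₁ + y, x₃ = P + 2^M X, x₄ = P + 2^M (Q + 2^K Y) and x₅ = b, where
-- P = x₁ + t = y + u and Q = X + V, the four pairs are x₁, x₁ - x₂ + x₃,
-- x₁ - x₃ + x₄ and x₁ - x₂ + x₄, each with x₅.
χ-clash : ∀ M K {x t y u X V} Y D {k} → x + t ≡ y + u →
  x * 2 < t → t < 2 ^ M → y * 2 < u → u < 2 ^ M → X * 2 < V → X + V < 2 ^ K →
  let b = x + t + 2 ^ M * (X + V + 2 ^ K * (Y + D)) in
  χ x b ≡ k → χ (u + 2 ^ M * X) b ≡ k →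
  χ (x + 2 ^ M * (V + 2 ^ K * Y)) b ≡ k → χ (u + 2 ^ M * (X + V + 2 ^ K * Y)) b ≡ k → ⊥
χ-clash M K {x} {t} {y} {u} {X} {V} Y D {k} P≡ x≪t t< y≪u u< X≪V Q< e₁ e₁₂₃ e₁₃₄ e₁₂₄ =
  -- The last two pairs enter the top block in states two apart, and two exchanges of sides carry
  -- this gap to the end.
  rot²≢id (run b Y D m) (begin
    rot (rot (run b Y D m))   ≡⟨ cong rot (run-swap b Y D m) ⟨
    rot (run b D Y (rot m))   ≡⟨ run-swap b D Y (rot m) ⟨
    run b Y D (rot (rot m))   ≡⟨ cong (run b Y D) n′≡ ⟨
    run b Y D n′              ≡⟨ trans (sym c₁₃₄) e₁₃₄ ⟩
    k                         ≡⟨ trans (sym e₁₂₄) c₁₂₄ ⟩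
    run b Y D m               ∎)
  where
  open ≡-Reasoning
  b = x + t + 2 ^ M * (X + V + 2 ^ K * (Y + D))

  below : ∀ {i j N} → i * 2 < j → j < N → i < N
  below {i} {j} i≪j j<N = ≤-<-trans (m≤m*n i 2) (<-trans i≪j j<N)

  x< = below x≪t t<
  y< = below y≪u u<
  V< = ≤-<-trans (m≤n+m V X) Q<
  X< = ≤-<-trans (m≤m+n X V) Q<
  0< = m^n>0 2 K

  -- States after the lowest block: `n` for 1 and 1 - 3 + 4, `m` for 1 - 2 + 3 and 1 - 2 + 4. After
  -- the next block: `m′` for 1 - 2 + 3, `n′` for 1 - 3 + 4.
  n m m′ n′ : Fin 4
  n = run M x t 0F
  m = run M u y 0F
  m′ = run K X V m
  n′ = run K V X n

  n-odd : Odd n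
  n-odd = run-leadʳ M 0F (<⇒≤ x≪t) (≤-<-trans z≤n x≪t) t<

  m-even : Even m
  m-even = run-leadˡ M 0F (<⇒≤ y≪u) (≤-<-trans z≤n y≪u) u<

  m′-odd : Odd m′
  m′-odd = run-leadʳ K m (<⇒≤ X≪V) (≤-<-trans z≤n X≪V) V<

  P≡′ : ∀ {z} → y + u + z ≡ x + t + z
  P≡′ {z} = cong (_+ z) (sym P≡)

  c₁ : χ x b ≡ n
  c₁ = begin
    χ x b                                  ≡⟨ cong (λ a → χ a b) (pad₁ (2 ^ M) (2 ^ K) x) ⟩
    χ (x + 2 ^ M * (0 + 2 ^ K * 0)) b      ≡⟨ χ-run M K x< t< 0< Q< (sum₁ (2 ^ M) (2 ^ K) x t (X + V) (Y + D)) ⟩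
    run b 0 (Y + D) (run K 0 (X + V) n)    ≡⟨ cong (run b 0 (Y + D)) (run-0ˡ K (X + V) n-odd) ⟩
    run b 0 (Y + D) n                      ≡⟨ run-0ˡ b (Y + D) n-odd ⟩
    n                                      ∎

  c₁₂₃ : χ (u + 2 ^ M * X) b ≡ m′
  c₁₂₃ = begin
    χ (u + 2 ^ M * X) b                    ≡⟨ cong (λ a → χ a b) (pad₂ (2 ^ M) (2 ^ K) u X) ⟩
    χ (u + 2 ^ M * (X + 2 ^ K * 0)) b      ≡⟨ χ-run M K u< y< X< V<
                                                (trans (sum₁₂₃ (2 ^ M) (2 ^ K) y u X V (Y + D)) P≡′) ⟩
    run b 0 (Y + D) m′                     ≡⟨ run-0ˡ b (Y + D) m′-odd ⟩
    m′                                     ∎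

  c₁₃₄ : χ (x + 2 ^ M * (V + 2 ^ K * Y)) b ≡ run b Y D n′
  c₁₃₄ = χ-run M K x< t< V< X< (sum₁₃₄ (2 ^ M) (2 ^ K) x t X V Y D)

  c₁₂₄ : χ (u + 2 ^ M * (X + V + 2 ^ K * Y)) b ≡ run b Y D m
  c₁₂₄ = trans
    (χ-run M K u< y< Q< 0< (trans (sum₁₂₄ (2 ^ M) (2 ^ K) y u (X + V) Y D) P≡′))
    (cong (run b Y D) (run-0ʳ K (X + V) m-even))

  m′≡n : m′ ≡ n
  m′≡n = trans (trans (sym c₁₂₃) e₁₂₃) (trans (sym e₁) c₁)

  rot³ : Fin 4 → Fin 4
  rot³ = rot ∘ rot ∘ rot

  rot⁶ : ∀ s → rot³ (rot³ s) ≡ rot (rot s)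
  rot⁶ 0F = refl
  rot⁶ 1F = refl
  rot⁶ 2F = refl
  rot⁶ 3F = refl

  -- Write `n` as `m ± 1`. The first two pairs give `m′ ≡ n`. Exchanging `X` and `V` and entering at
  -- `n` instead of `m` moves the outcome by the same `± 1`, so `n′` is `m ± 2`, and both signs
  -- agree modulo 4.
  n′≡ : n′ ≡ rot (rot m)
  n′≡ with odd-even n-odd m-even
  ... | inj₁ n≡ = begin
    n′                    ≡⟨ cong (run K V X) n≡ ⟩
    run K V X (rot m)     ≡⟨ run-swap K X V m ⟩
    rot m′                ≡⟨ cong rot (trans m′≡n n≡) ⟩
    rot (rot m)           ∎
  ... | inj₂ n≡ = begin
    n′                           ≡⟨ cong (run K V X) n≡ ⟩
    run K V X (rot³ m)           ≡⟨ run-swap K X V (rot (rot m)) ⟩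
    rot (run K X V (rot (rot m))) ≡⟨ cong rot (run-swap K V X (rot m)) ⟩
    rot (rot (run K V X (rot m))) ≡⟨ cong (rot ∘ rot) (run-swap K X V m) ⟩
    rot³ m′                      ≡⟨ cong rot³ (trans m′≡n n≡) ⟩
    rot³ (rot³ m)                ≡⟨ rot⁶ m ⟩
    rot (rot m)                  ∎

-- Alternating sums and residue classes

altSum₁ : ∀ i → ∣ altSum (i ∷ []) ∣ ≡ i
altSum₁ i = +-identityʳ i

-- The hypothesis is additive so that later values can be checked by identities in `ℕ`.
altSum₃ : ∀ i j k {a} → a + j ≡ i + k → ∣ altSum (i ∷ j ∷ k ∷ []) ∣ ≡ a
altSum₃ i j k {a} eq = cong ∣_∣ (begin
  + i - (+ j - (+ k - + 0))   ≡⟨ regroup (+ i) (+ j) (+ k) ⟩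
  (+ i ℤ.+ + k) - + j         ≡⟨ cong (λ z → + z - + j) eq ⟨
  (+ a ℤ.+ + j) - + j         ≡⟨ cancel (+ a) (+ j) ⟩
  + a                         ∎)
  where
  open ≡-Reasoning
  open ℤ using (+_; _-_)
  regroup : ∀ i j k → i - (j - (k - + 0)) ≡ (i ℤ.+ k) - j
  regroup = ℤ-RingSolver.solve-∀
  cancel : ∀ a j → (a ℤ.+ j) - j ≡ a
  cancel = ℤ-RingSolver.solve-∀

-- The residue class of `Q` modulo `2 ^ K`, parametrised from `Q` upwards.
aff : ℕ → ℕ → ℕ → ℕ
aff K Q w = Q + 2 ^ K * w

private
  aff-even : ∀ Q p v → Q + p * (v * 2) ≡ Q + 2 * p * v
  aff-even = solve-∀

  aff-odd : ∀ Q p v → Q + p * (1 + v * 2) ≡ Q + p + 2 * p * v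
  aff-odd = solve-∀

  aff-∘′ : ∀ r p Q q w → r + p * (Q + q * w) ≡ r + p * Q + q * p * w
  aff-∘′ = solve-∀

aff-∘ : ∀ M r K Q w → aff M r (aff K Q w) ≡ aff (K + M) (r + 2 ^ M * Q) w
aff-∘ M r K Q w = trans (aff-∘′ r (2 ^ M) Q (2 ^ K) w)
  (cong (λ z → r + 2 ^ M * Q + z * w) (sym (^-distribˡ-+-* 2 K M)))

aff-cancel-< : ∀ M r {Y Z} → aff M r Y < aff M r Z → Y < Z
aff-cancel-< M r lt = *-cancelˡ-< (2 ^ M) _ _ (+-cancelˡ-< r _ _ lt)

aff-large : ∀ M {r Y} → r < aff M r Y → Σ ℕ λ Y′ → Y ≡ suc Y′
aff-large M {r} {zero} lt
  with () ← <-irrefl (sym (trans (cong (r +_) (*-zeroʳ (2 ^ M))) (+-identityʳ r))) lt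
aff-large M {Y = suc Y′} _ = Y′ , refl

-- The factor 3 leaves more than twice `i` after `i` is removed, which puts the leading digit of `t`
-- strictly above that of `i`.
split : ∀ i {P N} → 3 * i < P → P < i + N → Σ ℕ λ t → P ≡ i + t × i * 2 < t × t < N
split i {P} {N} lo hi = P ∸ i , sym P≡ ,
  +-cancelˡ-< i _ _ (subst (_< i + (P ∸ i)) (3i i) (subst (3 * i <_) (sym P≡) lo)) ,
  +-cancelˡ-< i _ _ (subst (_< i + N) (sym P≡) hi)
  where
  P≡ : i + (P ∸ i) ≡ P
  P≡ = m+[n∸m]≡n (≤-trans (m≤n*m i 3) (<⇒≤ lo))
  3i : ∀ i → 3 * i ≡ i + i * 2
  3i = solve-∀

-- 2-adic accumulation of the sequence

module _ (x : ℕ → ℕ) (mono : ∀ i j → i < j → x i < x j) where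

  n≤xn : ∀ n → n ≤ x n
  n≤xn zero = z≤n
  n≤xn (suc n) = ≤-<-trans (n≤xn n) (mono n (suc n) ≤-refl)

  -- "Infinitely often", doubly negated so that a frequent half of a class can be chosen
  -- constructively; every goal is `⊥` in the end.
  Frequently : (ℕ → ℕ) → Set
  Frequently f = ∀ n → ¬ ¬ (∃₂ λ m w → n < m × x m ≡ f w)

  Frequently-cong : ∀ {f g} → (∀ w → f w ≡ g w) → Frequently f → Frequently g
  Frequently-cong f≡g F n k = F n λ (m , w , n<m , eq) → k (m , w , n<m , trans eq (f≡g w))

  -- Beyond both bounds, a term of the class would have a parameter that is neither even nor odd.
  Frequently-split : ∀ {f} → Frequently f →
    ¬ Frequently (λ v → f (v * 2)) → ¬ Frequently (λ v → f (1 + v * 2)) → ⊥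
  Frequently-split {f} F ¬E ¬O = ¬E λ n₁ ¬E₁ → ¬O λ n₂ ¬O₂ → F (n₁ ⊔ n₂) λ (m , w , n<m , eq) →
    parity w eq (≤-<-trans (m≤m⊔n n₁ n₂) n<m) (≤-<-trans (m≤n⊔m n₁ n₂) n<m) ¬E₁ ¬O₂
    where
    parity : ∀ {n₁ n₂ m} w → x m ≡ f w → n₁ < m → n₂ < m →
      ¬ (∃₂ λ m v → n₁ < m × x m ≡ f (v * 2)) → ¬ (∃₂ λ m v → n₂ < m × x m ≡ f (1 + v * 2)) → ⊥
    parity w eq n₁< n₂< ¬E₁ ¬O₂ with w % 2 | m≡m%n+[m/n]*n w 2 | m%n<n w 2
    ... | 0 | w≡ | _ = ¬E₁ (_ , w / 2 , n₁< , trans eq (cong f w≡))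
    ... | 1 | w≡ | _ = ¬O₂ (_ , w / 2 , n₂< , trans eq (cong f w≡))
    ... | suc (suc _) | _ | s≤s (s≤s ())

  -- The natural number `Q` is a 2-adic accumulation point of the parameters `w` at which `f w` is a
  -- term of the sequence.
  Stuck : (ℕ → ℕ) → ℕ → ℕ → Set
  Stuck f K Q = ∀ j → Frequently (f ∘ aff (j + K) Q)

  -- If only the digit 0 could be appended to a residue forever, that residue would be `Stuck`. So a
  -- digit 1 can be appended at some point, which raises the residue.
  unbounded : ∀ f → (∀ K Q → ¬ Stuck f K Q) → Frequently f → ∀ L →
    ¬ ¬ (∃₂ λ K Q → L ≤ Q × Q < 2 ^ K × Frequently (f ∘ aff K Q))
  unbounded f ¬S F zero k = k (0 , 0 , z≤n , s≤s z≤n , Frequently-cong (λ w → cong f (sym (*-identityˡ w))) F)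
  unbounded f ¬S F (suc L) k = unbounded f ¬S F L λ (K , Q , L≤Q , Q< , G) → ¬S K Q (extend K Q L≤Q Q< G)
    where
    extend : ∀ K Q → L ≤ Q → Q < 2 ^ K → Frequently (f ∘ aff K Q) → Stuck f K Q
    extend K Q L≤Q Q< G zero = G
    -- A frequent class with next digit 1 satisfies `k` at once, so the class with next digit 0 may
    -- be taken to be frequent.
    extend K Q L≤Q Q< G (suc j) n ¬w = Frequently-split (extend K Q L≤Q Q< G j)
      (λ E → Frequently-cong (λ v → cong f (aff-even Q (2 ^ (j + K)) v)) E n ¬w)
      (λ O → k (suc (j + K) , Q + 2 ^ (j + K) ,
        subst (_≤ Q + 2 ^ (j + K)) (+-comm L 1) (+-mono-≤ L≤Q (m^n>0 2 (j + K))) ,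
        subst (Q + 2 ^ (j + K) <_) (cong (2 ^ (j + K) +_) (sym (+-identityʳ _)))
          (+-monoˡ-< (2 ^ (j + K)) (<-≤-trans Q< (^-monoʳ-≤ 2 (m≤n+m K j)))) ,
        Frequently-cong (λ v → cong f (aff-odd Q (2 ^ (j + K)) v)) O))

  -- Widely spaced terms of one colour

  module _ {col : Fin 4}
    (mc : ∀ ks l → IsOdd (length ks) → Linked _<_ (ks ++ l ∷ []) → χ ∣ altSum (map x ks) ∣ (x l) ≡ col) where

    colour₁ : ∀ {i l} → i < l → χ (x i) (x l) ≡ col
    colour₁ {i} {l} i<l = trans (cong (λ a → χ a (x l)) (sym (altSum₁ (x i)))) (mc (i ∷ []) l one (i<l ∷ [-]))

    colour₃ : ∀ {i j k l a} → i < j → j < k → k < l → a + x j ≡ x i + x k → χ a (x l) ≡ col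
    colour₃ {i} {j} {k} {l} i<j j<k k<l eq = trans
      (cong (λ a → χ a (x l)) (sym (altSum₃ (x i) (x j) (x k) eq)))
      (mc (i ∷ j ∷ k ∷ []) l (plus2 one) (i<j ∷ j<k ∷ k<l ∷ [-]))

    -- Only `P - x k₁` and `P - y` must fit into `M` digits, so `P` itself may reach `2 ^ M`; the
    -- natural limit relies on this.
    configuration : ∀ M K {k₁ k₂ k₃ k₄ k₅ y P X Q Y Z} →
      k₁ < k₂ → k₂ < k₃ → k₃ < k₄ → k₄ < k₅ →
      x k₂ ≡ x k₁ + y →
      3 * x k₁ < P → P < x k₁ + 2 ^ M → 3 * y < P → P < y + 2 ^ M →
      3 * X < Q → Q < 2 ^ K →
      x k₃ ≡ aff M P X → x k₄ ≡ aff M P (aff K Q Y) → x k₅ ≡ aff M P (aff K Q Z) → ⊥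
    configuration M K {k₁} {k₂} {k₃} {k₄} {k₅} {y} {P} {X} {Q} {Y} {Z}
      k₁₂ k₂₃ k₃₄ k₄₅ x₂≡ x₁≪P P<x₁ y≪P P<y X≪Q Q< x₃≡ x₄≡ x₅≡
      with t , refl , x₁≪t , t< ← split (x k₁) x₁≪P P<x₁
         | u , P≡ , y≪u , u< ← split y y≪P P<y
         | V , refl , X≪V , V< ← split X X≪Q (<-≤-trans Q< (m≤n+m (2 ^ K) X))
      = χ-clash M K Y (Z ∸ Y) P≡ x₁≪t t< y≪u u< X≪V Q<
          (at₅ (colour₁ (<-trans k₁₂ (<-trans k₂₃ (<-trans k₃₄ k₄₅)))))
          (at₅ (colour₃ k₁₂ k₂₃ (<-trans k₃₄ k₄₅) eq₁₂₃))
          (at₅ (colour₃ (<-trans k₁₂ k₂₃) k₃₄ k₄₅ eq₁₃₄))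
          (at₅ (colour₃ k₁₂ (<-trans k₂₃ k₃₄) k₄₅ eq₁₂₄))
      where
      open ≡-Reasoning
      Y≤Z : Y ≤ Z
      Y≤Z = <⇒≤ (aff-cancel-< K Q (aff-cancel-< M P
        (subst (_< aff M P (aff K Q Z)) x₄≡ (subst (x k₄ <_) x₅≡ (mono _ _ k₄₅)))))

      at₅ : ∀ {a} → χ a (x k₅) ≡ col → χ a (aff M P (aff K Q (Y + (Z ∸ Y)))) ≡ col
      at₅ {a} = subst (λ b → χ a b ≡ col) (trans x₅≡ (cong (λ z → aff M P (aff K Q z)) (sym (m+[n∸m]≡n Y≤Z))))

      lem₂ : ∀ x y u w → u + w + (x + y) ≡ x + (y + u + w)
      lem₂ = solve-∀

      lem₃ : ∀ x p q P X V Y →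
        x + p * (V + q * Y) + (P + p * X) ≡ x + (P + p * (X + V + q * Y))
      lem₃ = solve-∀

      via₂ : ∀ {k} w → x k ≡ P + w → u + w + x k₂ ≡ x k₁ + x k
      via₂ {k} w eq = begin
        u + w + x k₂             ≡⟨ cong (u + w +_) x₂≡ ⟩
        u + w + (x k₁ + y)       ≡⟨ lem₂ (x k₁) y u w ⟩
        x k₁ + (y + u + w)       ≡⟨ cong (λ z → x k₁ + (z + w)) P≡ ⟨
        x k₁ + (P + w)           ≡⟨ cong (x k₁ +_) eq ⟨
        x k₁ + x k               ∎

      eq₁₂₃ : u + 2 ^ M * X + x k₂ ≡ x k₁ + x k₃
      eq₁₂₃ = via₂ _ x₃≡

      eq₁₂₄ : u + 2 ^ M * (X + V + 2 ^ K * Y) + x k₂ ≡ x k₁ + x k₄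
      eq₁₂₄ = via₂ _ x₄≡

      eq₁₃₄ : x k₁ + 2 ^ M * (V + 2 ^ K * Y) + x k₃ ≡ x k₁ + x k₄
      eq₁₃₄ = trans (cong (x k₁ + 2 ^ M * (V + 2 ^ K * Y) +_) x₃≡)
        (trans (lem₃ (x k₁) (2 ^ M) (2 ^ K) P X V Y) (cong (x k₁ +_) (sym x₄≡)))

    -- The residue stays at `p`, too small to subtract from, so one unit `2 ^ M` is moved into it
    -- from the quotient.
    natural-limit : ∀ {M₀ p} → ¬ Stuck id M₀ p
    natural-limit {M₀} {p} S = S j k₂ λ (k₃ , w₃ , k₂₃ , x₃≡) →
      third k₂₃ x₃≡ (aff-large M (subst (p <_) x₃≡ (p< (<-trans p<k₂ k₂₃))))
      where
      -- These indices make both `x k₁` and `y` exceed `p`, as `P < x k₁ + 2 ^ M` and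
      -- `P < y + 2 ^ M` require; `j` makes `2 ^ M` exceed `3 * x k₂`.
      k₁ = suc p
      k₂ = x k₁ + suc p
      y = x k₂ ∸ x k₁
      j = 3 * x k₂
      M = j + M₀
      P = p + 2 ^ M

      p< : ∀ {k} → p < k → p < x k
      p< p<k = <-≤-trans p<k (n≤xn _)

      p<k₂ : p < k₂
      p<k₂ = m≤n+m (suc p) (x k₁)

      k₁₂ : k₁ < k₂
      k₁₂ = +-mono-≤ (≤-trans (s≤s z≤n) (n≤xn k₁)) (≤-refl {suc p})

      3x₂<P : 3 * x k₂ < P
      3x₂<P = <-≤-trans (n<2^n j) (≤-trans (^-monoʳ-≤ 2 (m≤m+n j M₀)) (m≤n+m (2 ^ M) p))

      p<y : p < y
      p<y = m+n≤o⇒m≤o∸n (suc p) (subst (_≤ x k₂) (+-comm (x k₁) (suc p)) (n≤xn k₂))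

      shift : ∀ p q X → p + q * suc X ≡ p + q + q * X
      shift = solve-∀

      shift₂ : ∀ p q Q s Y → p + q * (suc Q + s * Y) ≡ p + q + q * (Q + s * Y)
      shift₂ = solve-∀

      third : ∀ {k₃ w₃} → k₂ < k₃ → x k₃ ≡ aff M p w₃ → Σ ℕ (λ X → w₃ ≡ suc X) → ⊥
      third {k₃} k₂₃ x₃≡ (X , refl) =
        F k₃ λ (k₄ , w₄ , k₃₄ , x₄≡) → F k₄ λ (k₅ , w₅ , k₄₅ , x₅≡) →
          last k₃₄ k₄₅ x₄≡ x₅≡ (positive k₃₄ x₄≡) (positive (<-trans k₃₄ k₄₅) x₅≡)
        where
        -- The borrowed unit turns `K` zero digits into ones, hence `Q`; this `K` ensures
        -- `3 * X < Q`.
        K = suc (3 * X)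
        Q = 2 ^ K ∸ 1

        1+Q≡ : suc Q ≡ 2 ^ K
        1+Q≡ = m+[n∸m]≡n (m^n>0 2 K)

        F : Frequently (aff (K + M) p)
        F = subst (λ e → Frequently (aff e p)) (+-assoc K j M₀) (S (K + j))

        positive : ∀ {k w} → k₃ < k → x k ≡ aff (K + M) p w → Σ ℕ λ w′ → w ≡ suc w′
        positive k₃< eq = aff-large (K + M) (subst (p <_) eq (p< (<-trans p<k₂ (<-trans k₂₃ k₃<))))

        rebase : ∀ Y → aff (K + M) p (suc Y) ≡ aff M P (aff K Q Y)
        rebase Y = begin
          p + 2 ^ (K + M) * suc Y              ≡⟨ cong (_+ 2 ^ (K + M) * suc Y)
                                                    (trans (cong (p +_) (*-zeroʳ (2 ^ M))) (+-identityʳ p)) ⟨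
          p + 2 ^ M * 0 + 2 ^ (K + M) * suc Y  ≡⟨ aff-∘ M p K 0 (suc Y) ⟨
          p + 2 ^ M * (2 ^ K * suc Y)          ≡⟨ cong (λ z → p + 2 ^ M * z) (*-suc (2 ^ K) Y) ⟩
          p + 2 ^ M * (2 ^ K + 2 ^ K * Y)      ≡⟨ cong (λ z → p + 2 ^ M * (z + 2 ^ K * Y)) 1+Q≡ ⟨
          p + 2 ^ M * (suc Q + 2 ^ K * Y)      ≡⟨ shift₂ p (2 ^ M) Q (2 ^ K) Y ⟩
          P + 2 ^ M * (Q + 2 ^ K * Y)          ∎
          where open ≡-Reasoning

        last : ∀ {k₄ w₄ k₅ w₅} → k₃ < k₄ → k₄ < k₅ → x k₄ ≡ aff (K + M) p w₄ → x k₅ ≡ aff (K + M) p w₅ →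
          Σ ℕ (λ Y → w₄ ≡ suc Y) → Σ ℕ (λ Z → w₅ ≡ suc Z) → ⊥
        last k₃₄ k₄₅ x₄≡ x₅≡ (Y , refl) (Z , refl) =
          configuration M K k₁₂ k₂₃ k₃₄ k₄₅
            (sym (m+[n∸m]≡n (<⇒≤ (mono _ _ k₁₂))))
            (≤-<-trans (*-monoʳ-≤ 3 (<⇒≤ (mono _ _ k₁₂))) 3x₂<P)
            (+-monoˡ-< (2 ^ M) (p< ≤-refl))
            (≤-<-trans (*-monoʳ-≤ 3 (m∸n≤m (x k₂) (x k₁))) 3x₂<P)
            (+-monoˡ-< (2 ^ M) p<y)
            (s≤s⁻¹ (subst (suc (suc (3 * X)) ≤_) (sym 1+Q≡) (n<2^n K)))
            (≤-reflexive 1+Q≡)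
            (trans x₃≡ (shift p (2 ^ M) X)) (trans x₄≡ (rebase Y)) (trans x₅≡ (rebase Z))

    no-natural-limit : ¬ (∀ K Q → ¬ Stuck id K Q)
    no-natural-limit ¬S =
      unbounded id ¬S (λ n k → k (suc n , x (suc n) , ≤-refl , refl)) (suc (3 * x 1)) λ (M , P , 3x₂<P , P< , F) →
      F 1 λ (k₃ , X , k₂₃ , x₃≡) →
      -- A natural limit `Q` of the quotients would make `P + 2 ^ M * Q` one of the sequence itself.
      unbounded (aff M P) (λ K Q S → ¬S (K + M) (P + 2 ^ M * Q) λ j →
        Frequently-cong (λ w → trans (aff-∘ M P (j + K) Q w)
          (cong (λ e → aff e (P + 2 ^ M * Q) w) (+-assoc j K M))) (S j))
        F (suc (3 * X)) λ (K , Q , 3X<Q , Q< , G) →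
      G k₃ λ (k₄ , Y , k₃₄ , x₄≡) →
      G k₄ λ (k₅ , Z , k₄₅ , x₅≡) →
      configuration M K {k₁ = 0} (s≤s z≤n) k₂₃ k₃₄ k₄₅
        (sym (m+[n∸m]≡n x₁≤x₂))
        (≤-<-trans (*-monoʳ-≤ 3 x₁≤x₂) 3x₂<P)
        (<-≤-trans P< (m≤n+m (2 ^ M) _))
        (≤-<-trans (*-monoʳ-≤ 3 (m∸n≤m (x 1) (x 0))) 3x₂<P)
        (<-≤-trans P< (m≤n+m (2 ^ M) _))
        3X<Q Q< x₃≡ x₄≡ x₅≡
      where
      x₁≤x₂ : x 0 ≤ x 1
      x₁≤x₂ = <⇒≤ (mono 0 1 (s≤s z≤n))

theorem2 : Σ ℕ λ c → Σ (ℕ → ℕ → Fin c) λ χ →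
    ¬ (Σ (ℕ → ℕ) λ x →
    (1 ≤ x 0) × (∀ i j → i < j → x i < x j) ×
    Σ (Fin c) λ col →
    ∀ (ks : List ℕ) (l : ℕ) → IsOdd (length ks) →
    Linked _<_ (ks ++ l ∷ []) →
    χ ∣ altSum (map x ks) ∣ (x l) ≡ col)
theorem2 = 4 , χ , λ (x , _ , mono , _ , mc) →
  no-natural-limit x mono mc (λ _ _ → natural-limit x mono mc)
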